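{- For every integer $d\ge 1$ and all positive integers $n_1,\ldots,n_d$, the grid graph $P_{n_1}\square P_{n_2}\square\cdots\square P_{n_d}$ is a $\lceil d/2\rceil$-OR-PCG.
   Context: All graphs are finite, simple, undirected, with nonempty vertex set. A weighted tree is a finite tree with strictly positive real edge weights. For a weighted tree $T$ and vertices $x,y$ of $T$, $d_T(x,y)$ is the total weight of the unique $x$–$y$ path, and $L(T)$ is the set of leaves of $T$ (the vertex of a one-vertex tree counts as a leaf). Grid graph: for positive integers $n_1,\ldots,n_d$, the graph $P_{n_1}\square\cdots\square P_{n_d}$ has vertex set $\{(x_1,\ldots,x_d)\in\mathbb{Z}^d: 0\le x_i\le n_i-1 \text{ for every } i\in\{1,\ldots,d\}\}$; two vertices are adjacent if and only if they differ by $1$ in exactly one coordinate and agree in every other coordinate. PCG (pairwise compatibility graph): a graph $G=(V,E)$ is a PCG if there exist a weighted tree $T$, a bijection $\zeta:V\to L(T)$, and real numbers $0\le d_{\min}\le d_{\max}$ such that for every pair of distinct vertices $u,v\in V$, $uv\in E$ if and only if $d_{\min}\le d_T(\zeta(u),\zeta(v))\le d_{\max}$. $k$-OR-PCG ($k\ge 1$): a graph $G=(V,E)$ is a $k$-OR-PCG if there exist PCGs $G_i=(V,E_i)$, $1\le i\le k$, on the same vertex set $V$, such that $E=E_1\cup E_2\cup\cdots\cup E_k$. -}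

module Defs where

open import Data.Fin.Base using (Fin; zero; suc; toℕ; fromℕ<)
import Data.Fin.Properties as Fin
open import Data.List.Base using (List; []; _∷_)
open import Data.List.Relation.Unary.Unique.Propositional using (Unique)
open import Data.Nat.Base as ℕ using (ℕ)
import Data.Nat.Properties as ℕ
open import Data.Product using (Σ; ∃; ∃!; _×_; _,_; uncurry; <_,_>)
open import Data.Product.Function.NonDependent.Propositional using (_×-↔_)
open import Data.Rational.Base as ℚ using (ℚ; 0ℚ; ½; _-_)
import Data.Rational.Properties as ℚ
open import Data.Rational.Solver using (module +-*-Solver)
open import Data.Sum.Base using (_⊎_)
open import Data.Vec.Base using (Vec; []; _∷_; lookup)
open import Data.Vec.Relation.Unary.All using (All; []; _∷_; head; tail)
open import Data.Vec.Relation.Unary.All.Properties using (lookup⁺; lookup⁻)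
open import Function.Base using (_∘_)
open import Function.Bundles using (_⇔_; _↔_; mk↔ₛ′)
open import Function.Definitions using (Injective)
open import Function.Construct.Composition using (_↔-∘_)
open import Function.Construct.Identity using (↔-id)
open import Function.Construct.Symmetry using (↔-sym)
open import Relation.Binary.Definitions using (Symmetric; Irreflexive; Decidable)
open import Relation.Binary.PropositionalEquality
  using (_≡_; _≢_; refl; sym; trans; cong; subst)
open import Relation.Nullary.Decidable using (_×-dec_; _→-dec_; ¬?)
open import Relation.Nullary.Negation using (¬_)

record ℝ : Set where
  field
    seq    : ℕ → ℚ
    cauchy : ∀ ε → 0ℚ ℚ.< ε →
             ∃ λ N → ∀ m n → N ℕ.≤ m → N ℕ.≤ n → ℚ.∣ seq m - seq n ∣ ℚ.< ε

open ℝ public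

fromℚ : ℚ → ℝ
fromℚ q .seq _ = q
fromℚ q .cauchy ε 0<ε = 0 , λ _ _ _ _ →
  subst (λ r → ℚ.∣ r ∣ ℚ.< ε) (sym (ℚ.+-inverseʳ q)) 0<ε

0ℝ : ℝ
0ℝ = fromℚ 0ℚ

infixl 6 _+ℝ_
infix  4 _≤ℝ_ _<ℝ_ _≃ℝ_

_+ℝ_ : ℝ → ℝ → ℝ
(x +ℝ y) .seq n = seq x n ℚ.+ seq y n
(x +ℝ y) .cauchy ε 0<ε =
  let half = ½ ℚ.* ε
      0<half = subst (ℚ._< half) (ℚ.*-zeroʳ ½) (ℚ.*-monoʳ-<-pos ½ 0<ε)
      M , Mx = cauchy x half 0<half
      N , Ny = cauchy y half 0<half
  in M ℕ.⊔ N , λ m n ≤m ≤n →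
     let a = seq x m ; b = seq x n ; c = seq y m ; d = seq y n
         x-close = Mx m n (ℕ.≤-trans (ℕ.m≤m⊔n M N) ≤m) (ℕ.≤-trans (ℕ.m≤m⊔n M N) ≤n)
         y-close = Ny m n (ℕ.≤-trans (ℕ.m≤n⊔m M N) ≤m) (ℕ.≤-trans (ℕ.m≤n⊔m M N) ≤n)
     in begin-strict
          ℚ.∣ (a ℚ.+ c) - (b ℚ.+ d) ∣          ≡⟨ cong ℚ.∣_∣ (regroup a b c d) ⟩
          ℚ.∣ (a - b) ℚ.+ (c - d) ∣            ≤⟨ ℚ.∣p+q∣≤∣p∣+∣q∣ (a - b) (c - d) ⟩
          ℚ.∣ a - b ∣ ℚ.+ ℚ.∣ c - d ∣          <⟨ ℚ.+-mono-< x-close y-close ⟩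
          half ℚ.+ half                        ≡⟨ sym (ℚ.*-distribʳ-+ ε ½ ½) ⟩
          (½ ℚ.+ ½) ℚ.* ε                      ≡⟨ ℚ.*-identityˡ ε ⟩
          ε                                    ∎
  where
  open ℚ.≤-Reasoning
  regroup : ∀ a b c d → (a ℚ.+ c) - (b ℚ.+ d) ≡ (a - b) ℚ.+ (c - d)
  regroup = solve 4 (λ a b c d → (a :+ c) :- (b :+ d) := (a :- b) :+ (c :- d)) refl
    where open +-*-Solver

_≤ℝ_ : ℝ → ℝ → Set
x ≤ℝ y = ∀ ε → 0ℚ ℚ.< ε → ∃ λ N → ∀ n → N ℕ.≤ n → seq x n ℚ.≤ seq y n ℚ.+ ε

_<ℝ_ : ℝ → ℝ → Set
x <ℝ y = ∃ λ ε → 0ℚ ℚ.< ε × ∃ λ N → ∀ n → N ℕ.≤ n → seq x n ℚ.+ ε ℚ.≤ seq y n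

-- Cauchy sequences are not quotiented: this is equality of the reals that
-- they represent.
_≃ℝ_ : ℝ → ℝ → Set
x ≃ℝ y = x ≤ℝ y × y ≤ℝ x

record Graph (V : Set) : Set₁ where
  infix 4 _~_ _~?_
  field
    order       : ℕ
    enumeration : V ↔ Fin order
    inhabitant  : V
    _~_         : V → V → Set
    _~?_        : Decidable _~_
    ~-sym       : Symmetric _~_
    ~-irrefl    : Irreflexive _≡_ _~_

module _ {V : Set} (G : Graph V) where
  open Graph G

  infixr 5 _∷_

  data Walk : V → V → Set where
    []  : ∀ {x} → Walk x x
    _∷_ : ∀ {x y z} → x ~ y → Walk y z → Walk x z

  vertices : ∀ {x y} → Walk x y → List V
  vertices {x} []      = x ∷ []
  vertices {x} (_ ∷ p) = x ∷ vertices p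

  length : ∀ {x y} → Walk x y → ℕ
  length []      = 0
  length (_ ∷ p) = ℕ.suc (length p)

  Path : V → V → Set
  Path x y = Σ (Walk x y) (Unique ∘ vertices)

  Connected : Set
  Connected = ∀ x y → Path x y

  -- A cycle is an edge x ~ y together with a path of length at least 2
  -- from y back to x.
  Acyclic : Set
  Acyclic = ∀ {x y} → x ~ y → ((p , _) : Path y x) → ¬ (2 ℕ.≤ length p)

  -- Degree one, or the only vertex of the graph.
  IsLeaf : V → Set
  IsLeaf x = ∃! _≡_ (x ~_) ⊎ (∀ y → y ≡ x)

record WeightedTree : Set₁ where
  field
    Vertex    : Set
    graph     : Graph Vertex
    connected : Connected graph
    acyclic   : Acyclic graph

  open Graph graph public using (_~_)

  -- The values of weight on non-adjacent pairs are irrelevant.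
  field
    weight     : Vertex → Vertex → ℝ
    weight-sym : ∀ {x y} → x ~ y → weight x y ≃ℝ weight y x
    weight-pos : ∀ {x y} → x ~ y → 0ℝ <ℝ weight x y

  walkWeight : ∀ {x y} → Walk graph x y → ℝ
  walkWeight []                = 0ℝ
  walkWeight (_∷_ {x} {y} _ p) = weight x y +ℝ walkWeight p

  -- By acyclicity, the path provided by connected is the only one
  -- from x to y.
  dist : Vertex → Vertex → ℝ
  dist x y = let p , _ = connected x y in walkWeight p

record IsPCG {V : Set} (G : Graph V) : Set₁ where
  open Graph G using () renaming (_~_ to _~G_)
  field
    T : WeightedTree

  open WeightedTree T

  -- ζ is a bijection from V onto the set of leaves of T: it is injective
  -- and its image is exactly that set.
  field
    ζ           : V → Vertex
    ζ-injective : Injective _≡_ _≡_ ζ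
    ζ-image     : ∀ x → IsLeaf graph x ⇔ ∃ λ v → ζ v ≡ x
    dmin dmax   : ℝ
    0≤dmin      : 0ℝ ≤ℝ dmin
    dmin≤dmax   : dmin ≤ℝ dmax
    compatible  : ∀ u v → u ≢ v →
                  u ~G v ⇔ (dmin ≤ℝ dist (ζ u) (ζ v) × dist (ζ u) (ζ v) ≤ℝ dmax)

record IsOrPCG (k : ℕ) {V : Set} (G : Graph V) : Set₁ where
  open Graph
  field
    1≤k    : 1 ℕ.≤ k
    member : Fin k → Graph V
    isPCG  : ∀ i → IsPCG (member i)
    union  : ∀ u v → _~_ G u v ⇔ ∃ λ i → _~_ (member i) u v

-- The range 0 ≤ xᵢ ≤ nᵢ - 1 of the i-th coordinate is encoded as Fin nᵢ.
GridVertex : ∀ {d} → Vec ℕ d → Set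
GridVertex = All Fin

coord : ∀ {d} {ns : Vec ℕ d} → GridVertex ns → (i : Fin d) → Fin (lookup ns i)
coord = lookup⁺

GridAdjacent : ∀ {d} {ns : Vec ℕ d} → GridVertex ns → GridVertex ns → Set
GridAdjacent x y = ∃ λ i →
  ℕ.∣ toℕ (coord x i) - toℕ (coord y i) ∣ ≡ 1 × (∀ j → j ≢ i → coord x j ≡ coord y j)

gridOrder : ∀ {d} → Vec ℕ d → ℕ
gridOrder []       = 1
gridOrder (n ∷ ns) = n ℕ.* gridOrder ns

gridEnumeration : ∀ {d} (ns : Vec ℕ d) → GridVertex ns ↔ Fin (gridOrder ns)
gridEnumeration []       =
  mk↔ₛ′ (λ _ → zero) (λ _ → []) (λ { zero → refl ; (suc ()) }) (λ { [] → refl })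
gridEnumeration (n ∷ ns) =
  ↔-sym Fin.*↔× ↔-∘ ((↔-id _ ×-↔ gridEnumeration ns) ↔-∘
  mk↔ₛ′ < head , tail > (uncurry _∷_) (λ _ → refl) (λ { (_ ∷ _) → refl }))

grid : ∀ {d} (ns : Vec ℕ d) → (∀ i → 1 ℕ.≤ lookup ns i) → Graph (GridVertex ns)
grid ns 1≤ns = record
  { order       = gridOrder ns
  ; enumeration = gridEnumeration ns
  ; inhabitant  = lookup⁻ (λ i → fromℕ< (1≤ns i))
  ; _~_         = GridAdjacent
  ; _~?_        = λ x y → Fin.any? λ i →
                    ℕ.∣ toℕ (coord x i) - toℕ (coord y i) ∣ ℕ.≟ 1
                      ×-dec Fin.all? λ j → ¬? (j Fin.≟ i) →-dec coord x j Fin.≟ coord y j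
  ; ~-sym       = λ { {x} {y} (i , diff , agree) →
                    i , trans (ℕ.∣-∣-comm (toℕ (coord y i)) (toℕ (coord x i))) diff
                      , λ j j≢i → sym (agree j j≢i) }
  ; ~-irrefl    = λ { {x} refl (i , diff , _) →
                    ℕ.1+n≢0 (trans (sym diff) (ℕ.∣n-n∣≡0 (toℕ (coord x i)))) }
  }

{-# OPTIONS --safe #-}

-- Group the coordinates into consecutive pairs; the edges in the directions of
-- one pair form disjoint copies ("layers", indexed by z) of a planar grid with
-- coordinates x ≤ X and y ≤ Y, and it suffices that such a union is a PCG.
-- Two points of the same planar grid are adjacent iff x + y changes by exactly
-- 1 and x - y by at most 1.  Take a caterpillar whose spine position is
-- p = x + y + K z, with K so large that layers are far apart, and whose spine
-- edges have large weight E.  With s = x + Y - y, give a vertex with x + y odd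
-- a leg of weight 1 + s, and one with x + y even a leg of weight A + (X + Y) - s.
-- The distance between an even u and an odd v is then a constant plus
-- E ∣ p u - p v ∣ + s v - s u, which lies in the window E - 1 ‥ E + 1 (plus the
-- constant) iff u and v are adjacent, while for A large the odd-odd distances
-- fall below the window and the even-even distances above it.
module Submission where

open import Defs
open import Data.Fin.Base using (Fin; zero; suc; toℕ; fromℕ; fromℕ<; inject₁)
import Data.Fin.Properties as Fin
open import Data.Integer.Base as ℤ using (+≤+; +<+) renaming (+_ to pos)
import Data.Integer.Properties as ℤ
open import Data.List.Relation.Unary.All as All using (All; []; _∷_)
open import Data.List.Relation.Unary.AllPairs using ([]; _∷_)
open import Data.List.Relation.Unary.Unique.Propositional using (Unique)
open import Data.Nat.Base
open import Data.Nat.Coprimality using (1-coprimeTo) renaming (sym to coprime-sym)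
open import Data.Nat.Properties
open import Data.Nat.Tactic.RingSolver using (solve-∀)
open import Data.Parity.Base as ℙ using (Parity; 0ℙ; 1ℙ)
import Data.Parity.Properties as ℙ
open import Data.Product using (∃; _×_; _,_; proj₁)
open import Data.Rational.Base as ℚ using (ℚ; mkℚ; ½; *≤*; *<*)
import Data.Rational.Properties as ℚ
import Data.Rational.Unnormalised.Base as ℚᵘ
import Data.Rational.Unnormalised.Properties as ℚᵘ
open import Data.Sum.Base as Sum using (_⊎_; inj₁; inj₂)
open import Data.Sum.Function.Propositional using (_⊎-↔_)
open import Data.Vec.Base using (Vec; []; _∷_; lookup)
open import Data.Vec.Relation.Unary.All using ([]; _∷_)
open import Function.Base using (_∘_; case_of_; id)
open import Function.Bundles using (_⇔_; mk⇔; mk↔ₛ′; Equivalence)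
open import Function.Construct.Composition using (_↔-∘_)
open import Function.Construct.Identity using (↔-id)
open import Function.Construct.Symmetry using (↔-sym)
open import Function.Properties.Inverse using (↔⇒↣)
open import Relation.Binary.Definitions using (DecidableEquality; tri<; tri≈; tri>)
open import Relation.Binary.PropositionalEquality
open import Relation.Nullary.Decidable using (Dec; yes; no; _×-dec_; _⊎-dec_; map′)
open import Relation.Nullary.Negation using (¬_; contradiction)

-- Reals given by natural numbers

-- Written directly in lowest terms, so that numerator and denominator compute for a variable `n`;
-- division by 1 would be stuck on a gcd.
ι : ℕ → ℚ
ι n = mkℚ (pos n) 0 (coprime-sym (1-coprimeTo n))

ι-homo-+ : ∀ m n → ι (m + n) ≡ ι m ℚ.+ ι n
ι-homo-+ m n = ℚ.toℚᵘ-injective (ℚᵘ.≃-trans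
  (ℚᵘ.*≡* (cong (ℤ._* pos 1)
    (cong₂ ℤ._+_ (sym (ℤ.*-identityʳ (pos m))) (sym (ℤ.*-identityʳ (pos n))))))
  (ℚᵘ.≃-sym (ℚ.toℚᵘ-homo-+ (ι m) (ι n))))

ι-mono-≤ : ∀ {m n} → m ≤ n → ι m ℚ.≤ ι n
ι-mono-≤ m≤n = *≤* (ℤ.*-monoʳ-≤-nonNeg (pos 1) (+≤+ m≤n))

-- All weights used below are constant sequences of naturals, so termwise equality is enough to move
-- every comparison of reals to ℕ. As a record it lets `x` and `n` be inferred.
record Represents (x : ℝ) (n : ℕ) : Set where
  constructor constantly
  field
    term : ∀ i → seq x i ≡ ι n

open Represents

fromℚ-ι : ∀ n → Represents (fromℚ (ι n)) n
fromℚ-ι n = constantly λ _ → refl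

0-represents : Represents 0ℝ 0
0-represents = constantly λ _ → refl

Represents-+ : ∀ {x y m n} → Represents x m → Represents y n → Represents (x +ℝ y) (m + n)
Represents-+ {m = m} {n} x≈m y≈n = constantly λ i →
  trans (cong₂ ℚ._+_ (term x≈m i) (term y≈n i)) (sym (ι-homo-+ m n))

≤⇒≤ℝ : ∀ {x y m n} → Represents x m → Represents y n → m ≤ n → x ≤ℝ y
≤⇒≤ℝ {n = n} x≈m y≈n m≤n ε 0<ε = 0 , λ i _ →
  subst₂ (λ a b → a ℚ.≤ b ℚ.+ ε) (sym (term x≈m i)) (sym (term y≈n i))
    (ℚ.≤-trans (ι-mono-≤ m≤n)
      (subst (ℚ._≤ ι n ℚ.+ ε) (ℚ.+-identityʳ (ι n)) (ℚ.+-monoʳ-≤ (ι n) (ℚ.<⇒≤ 0<ε))))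

≤ℝ⇒≤ : ∀ {x y m n} → Represents x m → Represents y n → x ≤ℝ y → m ≤ n
≤ℝ⇒≤ {m = m} {n} x≈m y≈n x≤y = ≮⇒≥ λ n<m →
  -- Distinct naturals are at least 1 apart, so any tolerance below 1 decides the order; ½ is taken.
  let N , le = x≤y ½ (*<* (+<+ z<s))
      n+1≤n+½ = begin
        ι n ℚ.+ ι 1   ≡⟨ ι-homo-+ n 1 ⟨
        ι (n + 1)     ≤⟨ ι-mono-≤ (subst (_≤ m) (+-comm 1 n) n<m) ⟩
        ι m           ≤⟨ subst₂ (λ a b → a ℚ.≤ b ℚ.+ ½) (term x≈m N) (term y≈n N) (le N ≤-refl) ⟩
        ι n ℚ.+ ½     ∎
  in ℚ.<-irrefl refl (ℚ.<-≤-trans (ℚ.+-monoʳ-< (ι n) ½<1) n+1≤n+½)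
  where
  open ℚ.≤-Reasoning
  ½<1 : ½ ℚ.< ι 1
  ½<1 = *<* (+<+ (s<s z<s))

-- The degenerate case: a one-node spine with a single leg would itself be a leaf. Here the edgeless
-- one-vertex graph `G` serves as its own tree.
singleton-isPCG : ∀ {V} (G : Graph V) → (∀ u v → u ≡ v) → IsPCG G
singleton-isPCG {V} G all-equal = record
  { T = record
    { Vertex     = V
    ; graph      = G
    ; connected  = λ u v → subst (Path G u) (all-equal u v) ([] , [] ∷ [])
    ; acyclic    = λ u~v _ _ → ~-irrefl (all-equal _ _) u~v
    ; weight     = λ _ _ → 0ℝ
    ; weight-sym = λ u~v → contradiction u~v (~-irrefl (all-equal _ _))
    ; weight-pos = λ u~v → contradiction u~v (~-irrefl (all-equal _ _))
    }
  ; ζ           = id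
  ; ζ-injective = id
  ; ζ-image     = λ u → mk⇔ (λ _ → u , refl) (λ _ → inj₂ λ v → all-equal v u)
  ; dmin        = 0ℝ
  ; dmax        = 0ℝ
  ; 0≤dmin      = ≤⇒≤ℝ 0-represents 0-represents z≤n
  ; dmin≤dmax   = ≤⇒≤ℝ 0-represents 0-represents z≤n
  ; compatible  = λ u v u≢v → contradiction (all-equal u v) u≢v
  }
  where open Graph G

-- Bridges and caterpillars

module _ {V : Set} (G : Graph V) where
  open Graph G

  target∈walk : ∀ {ℓ} {P : V → Set ℓ} {x y} (p : Walk G x y) → All P (vertices G p) → P y
  target∈walk []      (py ∷ _) = py
  target∈walk (_ ∷ p) (_ ∷ ps) = target∈walk p ps

  closed-path-trivial : ∀ {x} (p : Walk G x x) → Unique (vertices G p) → length G p ≡ 0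
  closed-path-trivial []      _         = refl
  closed-path-trivial (_ ∷ p) (x∉p ∷ _) = contradiction refl (target∈walk p x∉p)

  -- A certificate that an edge `y`-`x` is a bridge, when `y` lies in `S` and `x` does not.
  OnlyExit : (V → Set) → V → V → Set
  OnlyExit S y x = ∀ {u v} → u ~ v → S u → S v ⊎ (u ≡ y × v ≡ x)

  module _ {S : V → Set} {y x} (exit : OnlyExit S y x) (x∉S : ¬ S x) where

    exits-through : ∀ {w} → S w → (p : Walk G w x) → ¬ All (y ≢_) (vertices G p)
    exits-through w∈S []      _          = x∉S w∈S
    exits-through w∈S (e ∷ p) (y≢w ∷ y∉p) with exit e w∈S
    ... | inj₁ v∈S       = exits-through v∈S p y∉p
    ... | inj₂ (w≡y , _) = y≢w (sym w≡y)

    -- A path from `y` whose first step stays in `S` would have to revisit `y` in order to leave. So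
    -- the first step reaches `x`, and what remains is a closed path, hence empty.
    bridge-path-short : S y → ((p , _) : Path G y x) → length G p ≤ 1
    bridge-path-short y∈S ([]    , _)          = z≤n
    bridge-path-short y∈S (e ∷ p , y∉p ∷ uniq) with exit e y∈S
    ... | inj₁ v∈S        = contradiction y∉p (exits-through v∈S p)
    ... | inj₂ (_ , refl) = s≤s (≤-reflexive (closed-path-trivial p uniq))

-- One step along the spine. The bound by `k ⊔ q` keeps the new position within the spine.
toward : ∀ k q {n} → ∣ k - q ∣ ≡ suc n →
         ∃ λ k′ → (k′ ≡ suc k ⊎ k ≡ suc k′) × ∣ k′ - q ∣ ≡ n × k′ ≤ k ⊔ q
toward zero    (suc q) eq = 1 , inj₁ refl , suc-injective eq , s≤s z≤n
toward (suc k) zero    eq =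
  k , inj₂ refl , trans (∣-∣-identityʳ k) (suc-injective eq) , n≤1+n k
toward (suc k) (suc q) eq with toward k q eq
... | k′ , step , close , k′≤ =
  suc k′ , Sum.map (cong suc) (cong suc) step , close , s≤s k′≤

-- The spine is a path with `M` edges of weight `E`; `p` says where the leg of a vertex is attached
-- and `w` how much it weighs.
module Caterpillar {V : Set} (G : Graph V) (M E : ℕ) (p w : V → ℕ) where
  open Graph G using (order; enumeration)

  _≟V_ : DecidableEquality V
  _≟V_ = Fin.inj⇒≟ (↔⇒↣ enumeration)

  data Node : Set where
    leaf  : V → Node
    spine : Fin (suc M) → Node

  infix 4 _—_
  data _—_ : Node → Node → Set where
    leg  : ∀ {v k} → p v ≡ toℕ k → leaf v — spine k
    leg′ : ∀ {v k} → p v ≡ toℕ k → spine k — leaf v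
    up   : ∀ {k l} → toℕ l ≡ suc (toℕ k) → spine k — spine l
    down : ∀ {k l} → toℕ k ≡ suc (toℕ l) → spine k — spine l

  —-sym : ∀ {a b} → a — b → b — a
  —-sym (leg eq)  = leg′ eq
  —-sym (leg′ eq) = leg eq
  —-sym (up eq)   = down eq
  —-sym (down eq) = up eq

  _—?_ : ∀ a b → Dec (a — b)
  leaf _  —? leaf _  = no λ ()
  leaf v  —? spine k = map′ leg (λ { (leg eq) → eq }) (p v ≟ toℕ k)
  spine k —? leaf v  = map′ leg′ (λ { (leg′ eq) → eq }) (p v ≟ toℕ k)
  spine k —? spine l = map′ Sum.[ up , down ] (λ { (up eq) → inj₁ eq ; (down eq) → inj₂ eq })
    ((toℕ l ≟ suc (toℕ k)) ⊎-dec (toℕ k ≟ suc (toℕ l)))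

  caterpillar : Graph Node
  caterpillar = record
    { order       = order + suc M
    ; enumeration = ↔-sym Fin.+↔⊎ ↔-∘ ((enumeration ⊎-↔ ↔-id _) ↔-∘ mk↔ₛ′
        (λ { (leaf v) → inj₁ v ; (spine k) → inj₂ k }) Sum.[ leaf , spine ]
        (λ { (inj₁ _) → refl ; (inj₂ _) → refl }) (λ { (leaf _) → refl ; (spine _) → refl }))
    ; inhabitant  = spine zero
    ; _~_         = _—_
    ; _~?_        = _—?_
    ; ~-sym       = —-sym
    ; ~-irrefl    = λ { refl (up eq) → 1+n≢n (sym eq) ; refl (down eq) → 1+n≢n (sym eq) }
    }

  position : Node → ℕ
  position (leaf v)  = p v
  position (spine k) = toℕ k

  leg-exit : ∀ {v k} → p v ≡ toℕ k → OnlyExit caterpillar (_≡ leaf v) (leaf v) (spine k)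
  leg-exit eq (leg eq′) refl = inj₂ (refl , cong spine (Fin.toℕ-injective (trans (sym eq′) eq)))

  leg′-exit : ∀ {v k} → p v ≡ toℕ k → OnlyExit caterpillar (_≢ leaf v) (spine k) (leaf v)
  leg′-exit     eq (leg _)          _ = inj₁ λ ()
  leg′-exit {v} eq (leg′ {v′} eq′)  _ with v′ ≟V v
  ... | yes refl = inj₂ (cong spine (Fin.toℕ-injective (trans (sym eq′) eq)) , refl)
  ... | no v′≢v  = inj₁ λ { refl → v′≢v refl }
  leg′-exit     eq (up _)           _ = inj₁ λ ()
  leg′-exit     eq (down _)         _ = inj₁ λ ()

  -- Legs do not change `position` and spine edges change it by one, so the set of positions above
  -- `k` can only be left from `k + 1` to `k`.
  up-exit : ∀ {k l} → toℕ l ≡ suc (toℕ k) →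
            OnlyExit caterpillar (λ a → toℕ k < position a) (spine l) (spine k)
  up-exit {k} eq (leg eq′)  k< = inj₁ (subst (toℕ k <_) eq′ k<)
  up-exit {k} eq (leg′ eq′) k< = inj₁ (subst (toℕ k <_) (sym eq′) k<)
  up-exit     eq (up eq′)   k< = inj₁ (<-trans k< (≤-reflexive (sym eq′)))
  up-exit     eq (down eq′) k< with m≤n⇒m<n∨m≡n (s≤s⁻¹ (≤-trans k< (≤-reflexive eq′)))
  ... | inj₁ k<l′ = inj₁ k<l′
  ... | inj₂ k≡l′ = inj₂ ( cong spine (Fin.toℕ-injective (trans eq′ (trans (cong suc (sym k≡l′)) (sym eq))))
                         , cong spine (Fin.toℕ-injective (sym k≡l′)))

  down-exit : ∀ {k l} → toℕ k ≡ suc (toℕ l) →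
              OnlyExit caterpillar (λ a → position a < toℕ k) (spine l) (spine k)
  down-exit {k} eq (leg eq′)  <k = inj₁ (subst (_< toℕ k) eq′ <k)
  down-exit {k} eq (leg′ eq′) <k = inj₁ (subst (_< toℕ k) (sym eq′) <k)
  down-exit     eq (down eq′) <k = inj₁ (<-trans (≤-reflexive (sym eq′)) <k)
  down-exit     eq (up eq′)   <k with m≤n⇒m<n∨m≡n (≤-trans (≤-reflexive eq′) <k)
  ... | inj₁ l′<k = inj₁ l′<k
  ... | inj₂ l′≡k = inj₂ ( cong spine (Fin.toℕ-injective (suc-injective (trans (sym eq′) (trans l′≡k eq))))
                         , cong spine (Fin.toℕ-injective l′≡k))

  -- Acyclicity: every edge is a bridge. The path starts at `b`, so the cut is taken around `b`;
  -- this is why `leg` calls for `leg′-exit` and conversely.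
  path-to-neighbour-short : ∀ {a b} → a — b → ((q , _) : Path caterpillar b a) → length caterpillar q ≤ 1
  path-to-neighbour-short (leg eq)  =
    bridge-path-short caterpillar (leg′-exit eq) (λ x≢x → x≢x refl) λ ()
  path-to-neighbour-short (leg′ eq) = bridge-path-short caterpillar (leg-exit eq) (λ ()) refl
  path-to-neighbour-short (up eq)   =
    bridge-path-short caterpillar (up-exit eq) (<-irrefl refl) (≤-reflexive (sym eq))
  path-to-neighbour-short (down eq) =
    bridge-path-short caterpillar (down-exit eq) (<-irrefl refl) (≤-reflexive (sym eq))

  edgeWeight : Node → Node → ℕ
  edgeWeight (leaf v)  _         = w v
  edgeWeight (spine _) (leaf v)  = w v
  edgeWeight (spine _) (spine _) = E

  edgeWeight-sym : ∀ {a b} → a — b → edgeWeight a b ≡ edgeWeight b a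
  edgeWeight-sym (leg _)  = refl
  edgeWeight-sym (leg′ _) = refl
  edgeWeight-sym (up _)   = refl
  edgeWeight-sym (down _) = refl

  weightOf : ∀ {a b} → Walk caterpillar a b → ℕ
  weightOf []                = 0
  weightOf (_∷_ {a} {b} _ q) = edgeWeight a b + weightOf q

  legWeight : Node → ℕ
  legWeight (leaf v)  = w v
  legWeight (spine _) = 0

  -- The field inner says that the only leaf on a route is its target, so that
  -- a leg can be prefixed to the route.
  record Route (k : Fin (suc M)) (t : Node) (n : ℕ) : Set where
    field
      walk    : Walk caterpillar (spine k) t
      unique  : Unique (vertices caterpillar walk)
      nearer  : All (λ a → ∣ position a - position t ∣ ≤ n) (vertices caterpillar walk)
      inner   : All (λ a → ∀ v → a ≡ leaf v → a ≡ t) (vertices caterpillar walk)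
      weighs  : weightOf walk ≡ E * n + legWeight t

  open Route

  module _ (p≤M : ∀ v → p v ≤ M) where

    position≤M : ∀ a → position a ≤ M
    position≤M (leaf v)  = p≤M v
    position≤M (spine k) = Fin.toℕ≤pred[n] k

    route : ∀ n k t → ∣ toℕ k - position t ∣ ≡ n → Route k t n
    route zero k (leaf v) eq = record
      { walk   = leg′ (sym k≡) ∷ []
      ; unique = ((λ ()) ∷ []) ∷ [] ∷ []
      ; nearer = ≤-reflexive eq ∷ ≤-reflexive (∣n-n∣≡0 (p v)) ∷ []
      ; inner  = (λ _ ()) ∷ (λ _ _ → refl) ∷ []
      ; weighs = trans (+-identityʳ (w v)) (cong (_+ w v) (sym (*-zeroʳ E)))
      }
      where k≡ = ∣m-n∣≡0⇒m≡n {toℕ k} eq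
    route zero k (spine l) eq with Fin.toℕ-injective (∣m-n∣≡0⇒m≡n {toℕ k} eq)
    ... | refl = record
      { walk   = []
      ; unique = [] ∷ []
      ; nearer = ≤-reflexive eq ∷ []
      ; inner  = (λ _ _ → refl) ∷ []
      ; weighs = sym (trans (+-identityʳ (E * 0)) (*-zeroʳ E))
      }
    route (suc n) k t eq with toward (toℕ k) (position t) eq
    ... | k′ , step , close , k′≤ = record
      { walk   = edge ∷ walk r
      -- The new node is at distance `suc n` from the target and all later ones are within `n`, so
      -- it does not recur.
      ; unique = All.map (λ { a-near refl → <⇒≱ (≤-reflexive (sym eq)) a-near }) (nearer r) ∷ unique r
      ; nearer = ≤-reflexive eq ∷ All.map m≤n⇒m≤1+n (nearer r)
      ; inner  = (λ _ ()) ∷ inner r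
      ; weighs = begin
          E + weightOf (walk r)           ≡⟨ cong (E +_) (weighs r) ⟩
          E + (E * n + legWeight t)       ≡⟨ +-assoc E (E * n) (legWeight t) ⟨
          (E + E * n) + legWeight t       ≡⟨ cong (_+ legWeight t) (*-suc E n) ⟨
          E * suc n + legWeight t         ∎
      }
      where
      open ≡-Reasoning
      k′<1+M : k′ < suc M
      k′<1+M = s≤s (≤-trans k′≤ (⊔-lub (Fin.toℕ≤pred[n] k) (position≤M t)))
      l : Fin (suc M)
      l = fromℕ< k′<1+M
      l≡k′ : toℕ l ≡ k′
      l≡k′ = Fin.toℕ-fromℕ< k′<1+M
      edge : spine k — spine l
      edge = Sum.[ (λ e → up (trans l≡k′ e)) , (λ e → down (trans e (cong suc (sym l≡k′)))) ]′ step
      r : Route l t n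
      r = route n l t (trans (cong (λ j → ∣ j - position t ∣) l≡k′) close)

    foot : V → Fin (suc M)
    foot v = fromℕ< (s≤s (p≤M v))

    p≡foot : ∀ v → p v ≡ toℕ (foot v)
    p≡foot v = sym (Fin.toℕ-fromℕ< (s≤s (p≤M v)))

    leafRoute : ∀ u t → Route (foot u) t ∣ p u - position t ∣
    leafRoute u t = route _ _ t (cong (λ j → ∣ j - position t ∣) (sym (p≡foot u)))

    joined : ∀ a b → Path caterpillar a b
    joined (spine k) t = let r = route _ k t refl in walk r , unique r
    joined (leaf u)  t with t ≟leaf u
      where
      _≟leaf_ : ∀ t u → Dec (leaf u ≡ t)
      spine _ ≟leaf u = no λ ()
      leaf v  ≟leaf u = map′ (cong leaf) (λ { refl → refl }) (u ≟V v)
    -- Going down to the foot and back would repeat the leaf, so a leaf is joined to itself by the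
    -- empty path.
    ... | yes refl = [] , [] ∷ []
    ... | no u≢t   = leg (p≡foot u) ∷ walk r ,
                     All.map (λ { a≡t refl → u≢t (a≡t u refl) }) (inner r) ∷ unique r
      where r = leafRoute u t

    joined-weighs : ∀ {u v} → u ≢ v →
      weightOf (proj₁ (joined (leaf u) (leaf v))) ≡ w u + (E * ∣ p u - p v ∣ + w v)
    -- Abstracting over the test made inside `joined` lets that path reduce.
    joined-weighs {u} {v} u≢v with u ≟V v
    ... | yes u≡v = contradiction u≡v u≢v
    ... | no _    = cong (w u +_) (weighs (leafRoute u (leaf v)))

    module _ (1≤E : 1 ≤ E) (1≤w : ∀ v → 1 ≤ w v) where

      edgeWeight-pos : ∀ {a b} → a — b → 1 ≤ edgeWeight a b
      edgeWeight-pos (leg _)  = 1≤w _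
      edgeWeight-pos (leg′ _) = 1≤w _
      edgeWeight-pos (up _)   = 1≤E
      edgeWeight-pos (down _) = 1≤E

      tree : WeightedTree
      tree = record
        { Vertex     = Node
        ; graph      = caterpillar
        ; connected  = joined
        ; acyclic    = λ e q 2≤ → <⇒≱ 2≤ (path-to-neighbour-short e q)
        ; weight     = λ a b → fromℚ (ι (edgeWeight a b))
        ; weight-sym = λ e → ≤⇒≤ℝ (fromℚ-ι _) (fromℚ-ι _) (≤-reflexive (edgeWeight-sym e))
                           , ≤⇒≤ℝ (fromℚ-ι _) (fromℚ-ι _) (≤-reflexive (sym (edgeWeight-sym e)))
        ; weight-pos = λ {a} {b} e → ι 1 , *<* (+<+ z<s) , 0 , λ _ _ →
            subst (ℚ._≤ ι (edgeWeight a b)) (ι-homo-+ 0 1) (ι-mono-≤ (edgeWeight-pos e))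
        }

      open WeightedTree tree using (walkWeight; dist)

      walkWeight-ι : ∀ {a b} (q : Walk caterpillar a b) → Represents (walkWeight q) (weightOf q)
      walkWeight-ι []      = 0-represents
      walkWeight-ι (e ∷ q) = Represents-+ (fromℚ-ι _) (walkWeight-ι q)

      module _ {lo hi : ℕ} (lo≤hi : lo ≤ hi) (1≤M : 1 ≤ M)
        (bot top : V) (bot-first : p bot ≡ 0) (top-last : p top ≡ M) where

        -- An inner spine node has two spine neighbours. The two ends have one each, and the legs of
        -- `bot` and `top` supply the second neighbour.
        two-neighbours : ∀ k → ∃ λ a → ∃ λ b → spine k — a × spine k — b × a ≢ b
        two-neighbours zero =
          leaf bot , spine (fromℕ< (s≤s 1≤M)) , leg′ bot-first , up (Fin.toℕ-fromℕ< (s≤s 1≤M)) , λ ()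
        two-neighbours (suc k) with m≤n⇒m<n∨m≡n (Fin.toℕ≤pred[n] (suc k))
        ... | inj₂ 1+k≡M =
          spine (inject₁ k) , leaf top , down (cong suc (sym (Fin.toℕ-inject₁ k))) ,
          leg′ (trans top-last (sym 1+k≡M)) , λ ()
        ... | inj₁ 1+k<M =
          spine (inject₁ k) , spine l , down (cong suc (sym (Fin.toℕ-inject₁ k))) , up l≡2+k ,
          λ k≡l → m≢1+n+m (toℕ k) {1} (begin
            toℕ k             ≡⟨ Fin.toℕ-inject₁ k ⟨
            toℕ (inject₁ k)   ≡⟨ cong position k≡l ⟩
            toℕ l             ≡⟨ l≡2+k ⟩
            2 + toℕ k         ∎)
          where
          open ≡-Reasoning
          l = fromℕ< (s≤s 1+k<M)
          l≡2+k = Fin.toℕ-fromℕ< (s≤s 1+k<M)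

        spine-not-leaf : ∀ k → ¬ IsLeaf caterpillar (spine k)
        spine-not-leaf k (inj₂ all≡k) = case all≡k (leaf bot) of λ ()
        spine-not-leaf k (inj₁ (_ , _ , only)) with two-neighbours k
        ... | _ , _ , k—a , k—b , a≢b = a≢b (trans (sym (only k—a)) (only k—b))

        isPCG : (∀ u v → u ≢ v → let δ = w u + (E * ∣ p u - p v ∣ + w v) in
                   Graph._~_ G u v ⇔ (lo ≤ δ × δ ≤ hi)) → IsPCG G
        isPCG compat = record
          { T           = tree
          ; ζ           = leaf
          ; ζ-injective = λ { refl → refl }
          ; ζ-image     = λ a → mk⇔ (isLeaf⇒leaf a) λ { (v , refl) → leaf-isLeaf v }
          ; dmin        = fromℚ (ι lo)
          ; dmax        = fromℚ (ι hi)
          ; 0≤dmin      = ≤⇒≤ℝ 0-represents (fromℚ-ι lo) z≤n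
          ; dmin≤dmax   = ≤⇒≤ℝ (fromℚ-ι lo) (fromℚ-ι hi) lo≤hi
          ; compatible  = λ u v u≢v →
              let open Equivalence (compat u v u≢v)
                  dist≈δ = subst (Represents _) (joined-weighs u≢v)
                             (walkWeight-ι (proj₁ (joined (leaf u) (leaf v))))
              in mk⇔
                (λ u~v → let lo≤ , ≤hi = to u~v in
                  ≤⇒≤ℝ (fromℚ-ι lo) dist≈δ lo≤ , ≤⇒≤ℝ dist≈δ (fromℚ-ι hi) ≤hi)
                (λ (lo≤ , ≤hi) → from
                  (≤ℝ⇒≤ (fromℚ-ι lo) dist≈δ lo≤ , ≤ℝ⇒≤ dist≈δ (fromℚ-ι hi) ≤hi))
          }
          where
          isLeaf⇒leaf : ∀ a → IsLeaf caterpillar a → ∃ λ v → leaf v ≡ a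
          isLeaf⇒leaf (leaf v)  _      = v , refl
          isLeaf⇒leaf (spine k) isLeaf = contradiction isLeaf (spine-not-leaf k)
          leaf-isLeaf : ∀ v → IsLeaf caterpillar (leaf v)
          leaf-isLeaf v = inj₁ (spine (foot v) , leg (p≡foot v) ,
            λ { (leg eq) → cong spine (Fin.toℕ-injective (trans (sym (p≡foot v)) eq)) })

-- Disjoint unions of planar grids

-- Strictness is given by an explicit slack `k`, so that the ring solver can prove the hypothesis.
overshoot : ∀ {m n} k → n + suc k ≡ m → ¬ m ≤ n
overshoot k eq m≤n = m+1+n≰m _ (subst (_≤ _) (sym eq) m≤n)

∣-∣≡1⇒consecutive : ∀ m n → ∣ m - n ∣ ≡ 1 → n ≡ suc m ⊎ m ≡ suc n
∣-∣≡1⇒consecutive zero    n       eq = inj₁ eq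
∣-∣≡1⇒consecutive (suc m) zero    eq = inj₂ eq
∣-∣≡1⇒consecutive (suc m) (suc n) eq =
  Sum.map (cong suc) (cong suc) (∣-∣≡1⇒consecutive m n eq)

∣m-1+m∣≡1 : ∀ m → ∣ m - suc m ∣ ≡ 1
∣m-1+m∣≡1 zero    = refl
∣m-1+m∣≡1 (suc m) = ∣m-1+m∣≡1 m

-- Raising `z` gains at least `K`, which outweighs `c + a`. With `c` equal to 2 this separates
-- layers; with `c` equal to 1 it orders mixed radix numerals.
higher-digit : ∀ c K {a a′ z z′} → c + a ≤ K → z < z′ → c + (a + K * z) ≤ a′ + K * z′
higher-digit c K {a} {a′} {z} {z′} c+a≤K z<z′ = begin
  c + (a + K * z)   ≡⟨ +-assoc c a (K * z) ⟨
  c + a + K * z     ≤⟨ +-monoˡ-≤ (K * z) c+a≤K ⟩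
  K + K * z         ≡⟨ *-suc K z ⟨
  K * suc z         ≤⟨ *-monoʳ-≤ K z<z′ ⟩
  K * z′            ≤⟨ m≤n+m (K * z′) a′ ⟩
  a′ + K * z′       ∎
  where open ≤-Reasoning

-- Put a = x′ - x and b = y′ - y. Then a + b = 1 and the bounds on a - b give 0 ≤ 2a ≤ 2, so a is 0
-- or 1. Common terms are added to both sides to avoid subtraction.
ascent : ∀ x y x′ y′ → x′ + y′ ≡ suc (x + y) → x + y′ ≤ suc (x′ + y) → x′ + y ≤ suc (x + y′) →
         (x′ ≡ suc x × y′ ≡ y) ⊎ (x′ ≡ x × y′ ≡ suc y)
ascent x y x′ y′ sum le₁ le₂ with m≤n⇒m<n∨m≡n x≤x′
  where
  x≤x′ : x ≤ x′
  x≤x′ = *-cancelˡ-≤ 2 (+-cancelʳ-≤ (suc (y + y′)) (2 * x) (2 * x′) (begin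
    2 * x + suc (y + y′)              ≡⟨ eq₁ x y y′ ⟩
    (x + y′) + suc (x + y)            ≤⟨ +-mono-≤ le₁ (≤-reflexive (sym sum)) ⟩
    suc (x′ + y) + (x′ + y′)          ≡⟨ eq₂ x′ y y′ ⟩
    2 * x′ + suc (y + y′)             ∎))
    where
    open ≤-Reasoning
    eq₁ : ∀ x y y′ → 2 * x + suc (y + y′) ≡ (x + y′) + suc (x + y)
    eq₁ = solve-∀
    eq₂ : ∀ x′ y y′ → suc (x′ + y) + (x′ + y′) ≡ 2 * x′ + suc (y + y′)
    eq₂ = solve-∀
... | inj₂ refl = inj₂ (refl , +-cancelˡ-≡ x y′ (suc y) (trans sum (sym (+-suc x y))))
... | inj₁ x<x′ = inj₁ (x′≡1+x , +-cancelˡ-≡ (suc x) y′ y (subst (λ a → a + y′ ≡ suc (x + y)) x′≡1+x sum))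
  where
  x′≤1+x : x′ ≤ suc x
  x′≤1+x = *-cancelˡ-≤ 2 (+-cancelʳ-≤ (y + y′) (2 * x′) (2 * suc x) (begin
    2 * x′ + (y + y′)              ≡⟨ eq₁ x′ y y′ ⟩
    (x′ + y′) + (x′ + y)           ≤⟨ +-mono-≤ (≤-reflexive sum) le₂ ⟩
    suc (x + y) + suc (x + y′)     ≡⟨ eq₂ x y y′ ⟩
    2 * suc x + (y + y′)           ∎))
    where
    open ≤-Reasoning
    eq₁ : ∀ x′ y y′ → 2 * x′ + (y + y′) ≡ (x′ + y′) + (x′ + y)
    eq₁ = solve-∀
    eq₂ : ∀ x y y′ → suc (x + y) + suc (x + y′) ≡ 2 * suc x + (y + y′)
    eq₂ = solve-∀
  x′≡1+x : x′ ≡ suc x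
  x′≡1+x = ≤-antisym x′≤1+x x<x′

-- As r = S - s, the excess D - lo equals (3 + S)(δ - 1) + 1 + s′ - s. For δ = 1 it lies in 0 ‥ 2
-- iff s and s′ differ by at most 1. As s, s′ ≤ S, it is at most -2 for δ = 0 and at least 4 for δ ≥
-- 2.
window : ∀ A {S r s r′ s′} δ → r + s ≡ S → r′ + s′ ≡ S →
         let lo = A + S + (3 + S) ; D = (A + r) + ((3 + S) * δ + suc s′) in
         (lo ≤ D × D ≤ 2 + lo) ⇔ (δ ≡ 1 × s ≤ suc s′ × s′ ≤ suc s)
window A {r = r} {s} {r′} {s′} zero refl eq = mk⇔
  -- Adding `r′` on the right completes `s′` to the full sum, after which the bound is a polynomial
  -- identity with slack.
  (λ (lo≤ , _) → contradiction (≤-trans lo≤ (m≤m+n _ r′))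
    (overshoot (suc s) (trans
      (cong (_+ (2 + s)) (trans (sym (eq₂ A r r′ s′ s)) (cong (A + r + 1 +_) eq))) (eq₁ A r s))))
  (λ ())
  where
  eq₁ : ∀ A r s → (A + r + 1 + (r + s)) + suc (suc s) ≡ A + (r + s) + (3 + (r + s))
  eq₁ = solve-∀
  eq₂ : ∀ A r r′ s′ s → A + r + 1 + (r′ + s′) ≡ ((A + r) + ((3 + (r + s)) * 0 + suc s′)) + r′
  eq₂ = solve-∀
window A {r = r} {s} {r′} {s′} 1 refl _ = mk⇔
  (λ (lo≤ , ≤hi) → refl ,
    +-cancelˡ-≤ common s (suc s′) (subst₂ _≤_ lo≡ D≡ lo≤) ,
    s≤s⁻¹ (+-cancelˡ-≤ common (suc s′) (2 + s) (subst₂ _≤_ D≡ hi≡ ≤hi)))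
  (λ (_ , s≤ , s′≤) →
    subst₂ _≤_ (sym lo≡) (sym D≡) (+-monoʳ-≤ common s≤) ,
    subst₂ _≤_ (sym D≡) (sym hi≡) (+-monoʳ-≤ common (s≤s s′≤)))
  where
  common = A + r + (3 + (r + s))
  lo≡ : A + (r + s) + (3 + (r + s)) ≡ common + s
  lo≡ = eq A r s
    where eq : ∀ A r s → A + (r + s) + (3 + (r + s)) ≡ A + r + (3 + (r + s)) + s
          eq = solve-∀
  D≡ : (A + r) + ((3 + (r + s)) * 1 + suc s′) ≡ common + suc s′
  D≡ = eq A r s s′
    where eq : ∀ A r s s′ → (A + r) + ((3 + (r + s)) * 1 + suc s′) ≡ A + r + (3 + (r + s)) + suc s′
          eq = solve-∀
  hi≡ : 2 + (A + (r + s) + (3 + (r + s))) ≡ common + (2 + s)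
  hi≡ = eq A r s
    where eq : ∀ A r s → 2 + (A + (r + s) + (3 + (r + s))) ≡ A + r + (3 + (r + s)) + (2 + s)
          eq = solve-∀
window A {r = r} {s} {r′} {s′} (suc (suc δ)) refl _ = mk⇔
  (λ (_ , ≤hi) → contradiction ≤hi (overshoot _ (eq A r s s′ δ)))
  (λ ())
  where
  eq : ∀ A r s s′ δ → 2 + (A + (r + s) + (3 + (r + s))) + suc (1 + r + (3 + (r + s)) * δ + s′)
     ≡ (A + r) + ((3 + (r + s)) * (2 + δ) + suc s′)
  eq = solve-∀

-- The graph of layers and its caterpillar.

module Layers {V : Set} (G : Graph V) (x y z : V → ℕ) (bot top : V) where
  open Graph G using (order; enumeration; inhabitant)

  infix 4 _~_ _~?_
  _~_ : V → V → Set
  u ~ v = z u ≡ z v × ∣ x u - x v ∣ + ∣ y u - y v ∣ ≡ 1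

  _~?_ : ∀ u v → Dec (u ~ v)
  u ~? v = z u ≟ z v ×-dec ∣ x u - x v ∣ + ∣ y u - y v ∣ ≟ 1

  ~-sym : ∀ {u v} → u ~ v → v ~ u
  ~-sym {u} {v} (zu≡zv , near) = sym zu≡zv ,
    trans (cong₂ _+_ (∣-∣-comm (x v) (x u)) (∣-∣-comm (y v) (y u))) near

  ~-irrefl : ∀ {u v} → u ≡ v → ¬ u ~ v
  ~-irrefl {u} refl (_ , near) =
    0≢1+n (trans (sym (cong₂ _+_ (∣n-n∣≡0 (x u)) (∣n-n∣≡0 (y u)))) near)

  layers : Graph V
  layers = record
    { order       = order
    ; enumeration = enumeration
    ; inhabitant  = inhabitant
    ; _~_         = _~_
    ; _~?_        = _~?_
    ; ~-sym       = ~-sym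
    ; ~-irrefl    = ~-irrefl
    }

  module _
    (xbot≡0 : x bot ≡ 0) (ybot≡0 : y bot ≡ 0) (zbot≡0 : z bot ≡ 0)
    (x≤ : ∀ v → x v ≤ x top) (y≤ : ∀ v → y v ≤ y top) (z≤ : ∀ v → z v ≤ z top)
    (injective : ∀ {u v} → x u ≡ x v → y u ≡ y v → z u ≡ z v → u ≡ v) where

    X = x top
    Y = y top
    S = X + Y
    -- Since x + y ≤ S, positions in different layers differ by at least 2, so a difference of 1
    -- stays within a layer.
    K = 2 + S
    E = 3 + S

    -- `s` is x - y shifted by `Y` to remain natural, and `r` is S - s: a leg of weight `A + r` thus
    -- contributes s with a negative sign.
    p r s : V → ℕ
    p v = (x v + y v) + K * z v
    r v = (X ∸ x v) + y v
    s v = x v + (Y ∸ y v)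

    M = p top
    -- The summand S + E + 3 gives 2A > hi, which puts even-even distances above the window. The
    -- summand `E * M` bounds the spine part of any distance, so that odd-odd distances fall below
    -- `lo`.
    A = (S + E + 3) + E * M

    r+s≡S : ∀ v → r v + s v ≡ S
    r+s≡S v = trans (shuffle (X ∸ x v) (y v) (x v) (Y ∸ y v))
                    (cong₂ _+_ (m∸n+n≡m (x≤ v)) (m∸n+n≡m (y≤ v)))
      where
      shuffle : ∀ a b c d → (a + b) + (c + d) ≡ (a + c) + (d + b)
      shuffle = solve-∀

    s≤S : ∀ v → s v ≤ S
    s≤S v = m+n≤o⇒n≤o (r v) (≤-reflexive (r+s≡S v))

    p≤M : ∀ v → p v ≤ M
    p≤M v = +-mono-≤ (+-mono-≤ (x≤ v) (y≤ v)) (*-monoʳ-≤ K (z≤ v))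

    Close : V → V → Set
    Close u v = ∣ p u - p v ∣ ≡ 1 × s u ≤ suc (s v) × s v ≤ suc (s u)

    Close-sym : ∀ {u v} → Close u v → Close v u
    Close-sym {u} {v} (δ≡1 , s≤ , s′≤) = trans (∣-∣-comm (p v) (p u)) δ≡1 , s′≤ , s≤

    Ascends : V → V → Set
    Ascends u v = (x v ≡ suc (x u) × y v ≡ y u) ⊎ (x v ≡ x u × y v ≡ suc (y u))

    ascends-sum : ∀ {u v} → Ascends u v → x v + y v ≡ suc (x u + y u)
    ascends-sum     (inj₁ (xv≡ , yv≡)) = cong₂ _+_ xv≡ yv≡
    ascends-sum {u} (inj₂ (xv≡ , yv≡)) = trans (cong₂ _+_ xv≡ yv≡) (+-suc (x u) (y u))

    ascends-~ : ∀ {u v} → z u ≡ z v → Ascends u v → u ~ v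
    ascends-~ {u} {v} zu≡zv (inj₁ (xv≡ , yv≡)) = zu≡zv , cong₂ _+_
      (trans (cong (λ n → ∣ x u - n ∣) xv≡) (∣m-1+m∣≡1 (x u))) (m≡n⇒∣m-n∣≡0 (sym yv≡))
    ascends-~ {u} {v} zu≡zv (inj₂ (xv≡ , yv≡)) = zu≡zv , cong₂ _+_
      (m≡n⇒∣m-n∣≡0 (sym xv≡)) (trans (cong (λ n → ∣ y u - n ∣) yv≡) (∣m-1+m∣≡1 (y u)))

    ~-ascends : ∀ {u v} → u ~ v → Ascends u v ⊎ Ascends v u
    ~-ascends {u} {v} (_ , near)
      with ∣ x u - x v ∣ in dx | ∣ y u - y v ∣ in dy
    ... | 1 | 0 = Sum.map (λ eq → inj₁ (eq , sym (∣m-n∣≡0⇒m≡n dy))) (λ eq → inj₁ (eq , ∣m-n∣≡0⇒m≡n dy))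
                    (∣-∣≡1⇒consecutive (x u) (x v) dx)
    ... | 0 | 1 = Sum.map (λ eq → inj₂ (sym (∣m-n∣≡0⇒m≡n dx) , eq)) (λ eq → inj₂ (∣m-n∣≡0⇒m≡n dx , eq))
                    (∣-∣≡1⇒consecutive (y u) (y v) dy)

    -- The gap between layers forces equal `z`. The condition on `p` then concerns x + y, those on
    -- `s` concern x - y, and `ascent` applies.
    ascending : ∀ {u v} → p v ≡ suc (p u) → s u ≤ suc (s v) → s v ≤ suc (s u) →
      z u ≡ z v × Ascends u v
    ascending {u} {v} pv≡ su≤ sv≤ = zu≡zv , ascent (x u) (y u) (x v) (y v) sum
        (cross u v su≤) (cross v u sv≤)
      where
      separated : ∀ {a b} → z a < z b → 2 + p a ≤ p b
      separated {a} {b} = higher-digit 2 K {a′ = x b + y b} (s≤s (s≤s (+-mono-≤ (x≤ a) (y≤ a))))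

      zu≡zv : z u ≡ z v
      zu≡zv with <-cmp (z u) (z v)
      ... | tri< zu<zv _ _ = contradiction (≤-trans (separated zu<zv) (≤-reflexive pv≡)) 1+n≰n
      ... | tri≈ _ eq _    = eq
      ... | tri> _ _ zv<zu = contradiction
        (subst (λ n → 2 + n ≤ p u) pv≡ (separated zv<zu)) (λ le → m+1+n≰m (p u) {2}
          (subst (_≤ p u) (+-comm 3 (p u)) le))

      sum : x v + y v ≡ suc (x u + y u)
      sum = +-cancelʳ-≡ (K * z u) _ _ (trans (cong (λ h → x v + y v + K * h) zu≡zv) pv≡)

      -- Adding y a + y b to constant sides of the hypothesis removes the subtraction from Y.
      cross : ∀ a b → s a ≤ suc (s b) → x a + y b ≤ suc (x b + y a)
      cross a b sa≤ = +-cancelʳ-≤ Y _ _ (begin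
        (x a + y b) + Y                            ≡⟨ cong ((x a + y b) +_) (m∸n+n≡m (y≤ a)) ⟨
        (x a + y b) + ((Y ∸ y a) + y a)            ≡⟨ shuffle (x a) (y b) (Y ∸ y a) (y a) ⟩
        s a + (y a + y b)                          ≤⟨ +-monoˡ-≤ (y a + y b) sa≤ ⟩
        suc (s b) + (y a + y b)                    ≡⟨ shuffle′ (x b) (Y ∸ y b) (y a) (y b) ⟩
        suc (x b + y a) + ((Y ∸ y b) + y b)        ≡⟨ cong (suc (x b + y a) +_) (m∸n+n≡m (y≤ b)) ⟩
        suc (x b + y a) + Y                        ∎)
        where
        open ≤-Reasoning
        shuffle : ∀ a b c d → (a + b) + (c + d) ≡ (a + c) + (d + b)
        shuffle = solve-∀
        shuffle′ : ∀ a b c d → suc (a + b) + (c + d) ≡ suc (a + c) + (b + d)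
        shuffle′ = solve-∀

    close-ascending : ∀ {u v} → z u ≡ z v → Ascends u v → Close u v
    close-ascending {u} {v} zu≡zv step =
      trans (cong (λ n → ∣ p u - n ∣) pv≡) (∣m-1+m∣≡1 (p u)) , s-close step
      where
      pv≡ : p v ≡ suc (p u)
      pv≡ = cong₂ (λ a h → a + K * h) (ascends-sum step) (sym zu≡zv)

      s-close : Ascends u v → s u ≤ suc (s v) × s v ≤ suc (s u)
      s-close (inj₁ (xv≡ , yv≡)) =
        ≤-trans (n≤1+n (s u)) (≤-trans (≤-reflexive (sym sv≡)) (n≤1+n (s v))) , ≤-reflexive sv≡
        where
        sv≡ : s v ≡ suc (s u)
        sv≡ = cong₂ (λ a b → a + (Y ∸ b)) xv≡ yv≡
      s-close (inj₂ (xv≡ , yv≡)) =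
        ≤-reflexive su≡ , ≤-trans (n≤1+n (s v)) (≤-trans (≤-reflexive (sym su≡)) (n≤1+n (s u)))
        where
        su≡ : s u ≡ suc (s v)
        su≡ = begin
          -- Truncated subtraction is exact here because 1 + y u = y v ≤ Y.
          x u + (Y ∸ y u)                ≡⟨ cong (x u +_) (+-∸-assoc 1 (subst (_≤ Y) yv≡ (y≤ v))) ⟩
          x u + suc (Y ∸ suc (y u))      ≡⟨ +-suc (x u) _ ⟩
          suc (x u + (Y ∸ suc (y u)))    ≡⟨ cong suc (cong₂ (λ a b → a + (Y ∸ b)) xv≡ yv≡) ⟨
          suc (s v)                      ∎
          where open ≡-Reasoning

    ~⇒close : ∀ {u v} → u ~ v → Close u v
    ~⇒close u~v@(zu≡zv , _) = Sum.[ close-ascending zu≡zv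
                                  , (λ v↗u → Close-sym (close-ascending (sym zu≡zv) v↗u)) ]′ (~-ascends u~v)

    close⇒~ : ∀ {u v} → Close u v → u ~ v
    close⇒~ {u} {v} (δ≡1 , su≤ , sv≤) with ∣-∣≡1⇒consecutive (p u) (p v) δ≡1
    ... | inj₁ pv≡ = let zu≡zv , u↗v = ascending pv≡ su≤ sv≤ in ascends-~ zu≡zv u↗v
    ... | inj₂ pu≡ = let zv≡zu , v↗u = ascending pu≡ sv≤ su≤ in ~-sym (ascends-~ zv≡zu v↗u)

    colour : V → Parity
    colour v = parity (x v + y v)

    ascends-recolours : ∀ {u v} → Ascends u v → colour u ≢ colour v
    ascends-recolours {u} {v} u↗v eq = ℙ.p≢p⁻¹ (colour v) (begin
      colour v                              ≡⟨ eq ⟨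
      colour u                              ≡⟨ ℙ.suc-homo-⁻¹ (x u + y u) ⟨
      parity (suc (x u + y u)) ℙ.⁻¹         ≡⟨ cong (λ n → parity n ℙ.⁻¹) (ascends-sum u↗v) ⟨
      colour v ℙ.⁻¹                         ∎)
      where open ≡-Reasoning

    ~-recolours : ∀ {u v} → u ~ v → colour u ≢ colour v
    ~-recolours u~v eq =
      Sum.[ (λ u↗v → ascends-recolours u↗v eq) , (λ v↗u → ascends-recolours v↗u (sym eq)) ]′ (~-ascends u~v)

    shade : Parity → V → ℕ
    shade 0ℙ v = A + r v
    shade 1ℙ v = suc (s v)

    w : V → ℕ
    w v = shade (colour v) v

    lo hi : ℕ
    lo = A + S + E
    hi = 2 + lo

    compatible : ∀ u v → let D = w u + (E * ∣ p u - p v ∣ + w v) in u ~ v ⇔ (lo ≤ D × D ≤ hi)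
    -- Generalising over the two colours lets the leg weights reduce to the clauses of `shade`; the
    -- equations retain the link to the vertices.
    compatible u v = by-colour (colour u) (colour v) refl refl
      where
      δ = ∣ p u - p v ∣

      δ≤M : δ ≤ M
      δ≤M = ≤-trans (∣m-n∣≤m⊔n (p u) (p v)) (⊔-lub (p≤M u) (p≤M v))

      monochrome : ∀ {P : Set} → colour u ≡ colour v → ¬ P → u ~ v ⇔ P
      monochrome eq ¬P = mk⇔ (λ u~v → contradiction eq (~-recolours u~v)) (λ P → contradiction P ¬P)

      bichrome : ∀ {P : Set} → P ⇔ Close u v → u ~ v ⇔ P
      bichrome P⇔close = mk⇔ (from ∘ ~⇒close) (close⇒~ ∘ to)
        where open Equivalence P⇔close

      by-colour : ∀ cu cv → colour u ≡ cu → colour v ≡ cv →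
                  let D = shade cu u + (E * δ + shade cv v) in u ~ v ⇔ (lo ≤ D × D ≤ hi)
      by-colour 0ℙ 1ℙ _ _ = bichrome (window A {r = r u} {s u} {r v} {s v} δ (r+s≡S u) (r+s≡S v))
      -- The distance is symmetric, so `window` is applied with the even vertex `v` first.
      by-colour 1ℙ 0ℙ _ _ = bichrome (mk⇔ (Close-sym ∘ to ∘ subst P D≡) (subst P (sym D≡) ∘ from ∘ Close-sym))
        where
        P : ℕ → Set
        P D = lo ≤ D × D ≤ hi
        open Equivalence (window A {r = r v} {s v} {r u} {s u} ∣ p v - p u ∣ (r+s≡S v) (r+s≡S u))
        swap : ∀ a b c → a + (b + c) ≡ c + (b + a)
        swap = solve-∀
        D≡ : suc (s u) + (E * δ + (A + r v)) ≡ (A + r v) + (E * ∣ p v - p u ∣ + suc (s u))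
        D≡ = trans (swap (suc (s u)) (E * δ) (A + r v))
                   (cong (λ d → (A + r v) + (E * d + suc (s u))) (∣-∣-comm (p u) (p v)))
      by-colour 1ℙ 1ℙ cu≡ cv≡ = monochrome (trans cu≡ (sym cv≡)) λ (lo≤D , _) →
        overshoot (6 + S + S) (eq S (E * M)) (≤-trans lo≤D
          (+-mono-≤ (s≤s (s≤S u)) (+-mono-≤ (*-monoʳ-≤ E δ≤M) (s≤s (s≤S v)))))
        where
        eq : ∀ S m → (suc S + (m + suc S)) + suc (6 + S + S) ≡ (S + (3 + S) + 3 + m) + S + (3 + S)
        eq = solve-∀
      by-colour 0ℙ 0ℙ cu≡ cv≡ = monochrome (trans cu≡ (sym cv≡)) λ (_ , D≤hi) →
        overshoot _ (eq S (E * M) (r u) (E * δ) (r v)) D≤hi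
        where
        eq : ∀ S m a d b → let A = S + (3 + S) + 3 + m in
             2 + (A + S + (3 + S)) + suc (m + a + d + b) ≡ (A + a) + (d + (A + b))
        eq = solve-∀

    1≤w : ∀ v → 1 ≤ w v
    1≤w v = by-shade (colour v)
      where
      by-shade : ∀ c → 1 ≤ shade c v
      by-shade 0ℙ = ≤-trans (≤-trans (≤-trans (s≤s z≤n) (m≤n+m 3 (S + E))) (m≤m+n _ (E * M))) (m≤m+n A (r v))
      by-shade 1ℙ = s≤s z≤n

    layers-isPCG : IsPCG layers
    layers-isPCG with M ≟ 0
    ... | no M≢0  = Caterpillar.isPCG layers M E p w p≤M (s≤s z≤n) 1≤w (m≤n+m lo 2) (n≢0⇒n>0 M≢0)
                      bot top (cong₂ _+_ (cong₂ _+_ xbot≡0 ybot≡0) (trans (cong (K *_) zbot≡0) (*-zeroʳ K))) refl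
                      λ u v _ → compatible u v
    -- All coordinates of `top` vanish, hence all coordinates of every vertex, and `injective`
    -- leaves a single vertex.
    ... | yes M≡0 = singleton-isPCG layers λ u v → injective
                      (constant x≤ X≡0 u v) (constant y≤ Y≡0 u v) (constant z≤ Z≡0 u v)
      where
      S≡0 = m+n≡0⇒m≡0 S M≡0
      X≡0 = m+n≡0⇒m≡0 X S≡0
      Y≡0 = m+n≡0⇒n≡0 X S≡0
      Z≡0 = m+n≡0⇒m≡0 (z top) (m+n≡0⇒n≡0 S M≡0)
      constant : ∀ {f : V → ℕ} {n} → (∀ v → f v ≤ n) → n ≡ 0 → ∀ u v → f u ≡ f v
      constant f≤ refl u v = trans (n≤0⇒n≡0 (f≤ u)) (sym (n≤0⇒n≡0 (f≤ v)))

-- Coordinates of grid vertices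

digits-injective : ∀ {n} (a b : Fin n) {z z′} →
                   toℕ a + n * z ≡ toℕ b + n * z′ → a ≡ b × z ≡ z′
digits-injective {n} a b {z} {z′} eq with <-cmp z z′
... | tri< z<z′ _ _ = contradiction eq (<⇒≢ (higher-digit 1 n (Fin.toℕ<n a) z<z′))
... | tri≈ _ refl _ = Fin.toℕ-injective (+-cancelʳ-≡ (n * z) (toℕ a) (toℕ b) eq) , refl
... | tri> _ _ z′<z = contradiction (sym eq) (<⇒≢ (higher-digit 1 n (Fin.toℕ<n b) z′<z))

-- The value 0 out of range supplies the missing partner of the last coordinate
-- when d is odd.
at : ∀ {d} {ns : Vec ℕ d} → ℕ → GridVertex ns → ℕ
at _       []      = 0
at zero    (a ∷ _) = toℕ a
at (suc c) (_ ∷ u) = at c u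

-- A mixed radix numeral with the side lengths as bases, least significant digit first.
code : ∀ {d} {ns : Vec ℕ d} → GridVertex ns → ℕ
code              []      = 0
code {ns = n ∷ _} (a ∷ u) = toℕ a + n * code u

-- Mixed radix code of all coordinates other than c and c + 1.
rest : ∀ {d} {ns : Vec ℕ d} → ℕ → GridVertex ns → ℕ
rest _       []          = 0
rest zero    (_ ∷ [])    = 0
rest zero    (_ ∷ _ ∷ u) = code u
rest {ns = n ∷ _} (suc c) (a ∷ u) = toℕ a + n * rest c u

code-injective : ∀ {d} {ns : Vec ℕ d} (u v : GridVertex ns) → code u ≡ code v → u ≡ v
code-injective []      []      _  = refl
code-injective (a ∷ u) (b ∷ v) eq with digits-injective a b eq
... | refl , eq′ = cong (a ∷_) (code-injective u v eq′)

coordinates-injective : ∀ {d} {ns : Vec ℕ d} c (u v : GridVertex ns) →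
  at c u ≡ at c v → at (suc c) u ≡ at (suc c) v → rest c u ≡ rest c v → u ≡ v
coordinates-injective _    []           []           _ _ _ = refl
coordinates-injective zero (a ∷ [])     (b ∷ [])     a≡b _ _ = cong (_∷ []) (Fin.toℕ-injective a≡b)
coordinates-injective zero (a ∷ a′ ∷ u) (b ∷ b′ ∷ v) a≡b a′≡b′ eq
  with refl ← Fin.toℕ-injective a≡b | refl ← Fin.toℕ-injective a′≡b′ =
  cong (λ t → a ∷ a′ ∷ t) (code-injective u v eq)
coordinates-injective (suc c) (a ∷ u) (b ∷ v) eq₁ eq₂ eq with digits-injective a b eq
... | refl , eq′ = cong (a ∷_) (coordinates-injective c u v eq₁ eq₂ eq′)

greatest : ∀ {n} → 1 ≤ n → Fin n
greatest {suc n} _ = fromℕ n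

≤greatest : ∀ {n} (1≤n : 1 ≤ n) (a : Fin n) → toℕ a ≤ toℕ (greatest 1≤n)
≤greatest {suc _} _ a = Fin.≤fromℕ a

-- `at`, `code` and `rest` are monotone in every coordinate, so these opposite corners attain all
-- their extremes at once.
bottom top : ∀ {d} (ns : Vec ℕ d) → (∀ i → 1 ≤ lookup ns i) → GridVertex ns
bottom []       _    = []
bottom (n ∷ ns) 1≤ns = fromℕ< (1≤ns zero) ∷ bottom ns (1≤ns ∘ suc)
top    []       _    = []
top    (n ∷ ns) 1≤ns = greatest (1≤ns zero) ∷ top ns (1≤ns ∘ suc)

at-bottom : ∀ {d} c (ns : Vec ℕ d) 1≤ns → at c (bottom ns 1≤ns) ≡ 0
at-bottom _       []       _    = refl
at-bottom zero    (n ∷ ns) 1≤ns = Fin.toℕ-fromℕ< (1≤ns zero)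
at-bottom (suc c) (n ∷ ns) 1≤ns = at-bottom c ns (1≤ns ∘ suc)

digits-zero : ∀ n {a z} → a ≡ 0 → z ≡ 0 → a + n * z ≡ 0
digits-zero n refl refl = *-zeroʳ n

code-bottom : ∀ {d} (ns : Vec ℕ d) 1≤ns → code (bottom ns 1≤ns) ≡ 0
code-bottom []       _    = refl
code-bottom (n ∷ ns) 1≤ns =
  digits-zero n (Fin.toℕ-fromℕ< (1≤ns zero)) (code-bottom ns (1≤ns ∘ suc))

rest-bottom : ∀ {d} c (ns : Vec ℕ d) 1≤ns → rest c (bottom ns 1≤ns) ≡ 0
rest-bottom _       []           _    = refl
rest-bottom zero    (_ ∷ [])     _    = refl
rest-bottom zero    (_ ∷ _ ∷ ns) 1≤ns = code-bottom ns (λ i → 1≤ns (suc (suc i)))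
rest-bottom (suc c) (n ∷ ns)     1≤ns =
  digits-zero n (Fin.toℕ-fromℕ< (1≤ns zero)) (rest-bottom c ns (1≤ns ∘ suc))

at≤top : ∀ {d} c (ns : Vec ℕ d) 1≤ns (u : GridVertex ns) → at c u ≤ at c (top ns 1≤ns)
at≤top _       []       _    []      = z≤n
at≤top zero    (n ∷ ns) 1≤ns (a ∷ u) = ≤greatest (1≤ns zero) a
at≤top (suc c) (n ∷ ns) 1≤ns (a ∷ u) = at≤top c ns (1≤ns ∘ suc) u

code≤top : ∀ {d} (ns : Vec ℕ d) 1≤ns (u : GridVertex ns) → code u ≤ code (top ns 1≤ns)
code≤top []       _    []      = z≤n
code≤top (n ∷ ns) 1≤ns (a ∷ u) =
  +-mono-≤ (≤greatest (1≤ns zero) a) (*-monoʳ-≤ n (code≤top ns (1≤ns ∘ suc) u))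

rest≤top : ∀ {d} c (ns : Vec ℕ d) 1≤ns (u : GridVertex ns) → rest c u ≤ rest c (top ns 1≤ns)
rest≤top _       []           _    []          = z≤n
rest≤top zero    (_ ∷ [])     _    (_ ∷ [])    = z≤n
rest≤top zero    (_ ∷ _ ∷ ns) 1≤ns (_ ∷ _ ∷ u) = code≤top ns (λ i → 1≤ns (suc (suc i))) u
rest≤top (suc c) (n ∷ ns)     1≤ns (a ∷ u)     =
  +-mono-≤ (≤greatest (1≤ns zero) a) (*-monoʳ-≤ n (rest≤top c ns (1≤ns ∘ suc) u))

-- Grid adjacency as a step in one of two paired directions.

data Step : ∀ {d} {ns : Vec ℕ d} → ℕ → GridVertex ns → GridVertex ns → Set where
  here  : ∀ {d n} {ns : Vec ℕ d} {a b : Fin n} {u : GridVertex ns} →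
          ∣ toℕ a - toℕ b ∣ ≡ 1 → Step 0 (a ∷ u) (b ∷ u)
  there : ∀ {d n c} {ns : Vec ℕ d} {a : Fin n} {u v : GridVertex ns} →
          Step c u v → Step (suc c) (a ∷ u) (a ∷ v)

coord-extensional : ∀ {d} {ns : Vec ℕ d} (u v : GridVertex ns) → (∀ j → coord u j ≡ coord v j) → u ≡ v
coord-extensional []      []      _  = refl
coord-extensional (a ∷ u) (b ∷ v) eq = cong₂ _∷_ (eq zero) (coord-extensional u v (eq ∘ suc))

-- Pointwise agreement off one coordinate becomes literal sharing of the other entries, which makes
-- induction on the step possible.
adjacent⇒step : ∀ {d} {ns : Vec ℕ d} (u v : GridVertex ns) →
                GridAdjacent u v → ∃ λ (i : Fin d) → Step (toℕ i) u v
adjacent⇒step (a ∷ u) (b ∷ v) (zero , diff , agree)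
  with refl ← coord-extensional u v (λ j → agree (suc j) λ ()) = zero , here diff
adjacent⇒step (a ∷ u) (b ∷ v) (suc i , diff , agree)
  with refl ← agree zero (λ ())
     | j , step ← adjacent⇒step u v (i , diff , λ j j≢i → agree (suc j) (j≢i ∘ Fin.suc-injective)) =
  suc j , there step

adjacent-∷ : ∀ {d n} {ns : Vec ℕ d} {a : Fin n} {u v : GridVertex ns} →
             GridAdjacent u v → GridAdjacent (a ∷ u) (a ∷ v)
adjacent-∷ (i , diff , agree) =
  suc i , diff , λ { zero _ → refl ; (suc j) j≢i → agree j (j≢i ∘ cong suc) }

step⇒adjacent : ∀ {d c} {ns : Vec ℕ d} {u v : GridVertex ns} → Step c u v → GridAdjacent u v
step⇒adjacent (here diff)  = zero , diff , λ { zero 0≢0 → contradiction refl 0≢0 ; (suc _) _ → refl }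
step⇒adjacent (there step) = adjacent-∷ (step⇒adjacent step)

-- Definitionally the edge relation of `layers` for the coordinates c and c + 1.
Near : ∀ {d} {ns : Vec ℕ d} → ℕ → GridVertex ns → GridVertex ns → Set
Near c u v = rest c u ≡ rest c v × ∣ at c u - at c v ∣ + ∣ at (suc c) u - at (suc c) v ∣ ≡ 1

step⇒near : ∀ {d c} {ns : Vec ℕ d} {u v : GridVertex ns} → Step c u v → Near c u v
-- The second coordinate of the pair is missing; both vertices take the default 0 there.
step⇒near (here {u = []} diff)                    = refl , trans (+-identityʳ _) diff
step⇒near (here {u = a ∷ _} diff)                 = refl , cong₂ _+_ diff (∣n-n∣≡0 (toℕ a))
step⇒near (there {n = n} {a = a} step) with step⇒near step
... | eq , near = cong (λ z → toℕ a + n * z) eq , near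

next-step⇒near : ∀ {d} c {ns : Vec ℕ d} {u v : GridVertex ns} → Step (suc c) u v → Near c u v
next-step⇒near zero    (there {a = a} (here diff)) = refl , cong₂ _+_ (∣n-n∣≡0 (toℕ a)) diff
next-step⇒near (suc c) (there {n = n} {a = a} step) with next-step⇒near c step
... | eq , near = cong (λ z → toℕ a + n * z) eq , near

-- Equal codes force agreement outside the pair, and the two differences sum to 1 only as 1 + 0 or 0
-- + 1.
near⇒adjacent : ∀ {d} c {ns : Vec ℕ d} (u v : GridVertex ns) → Near c u v → GridAdjacent u v
near⇒adjacent zero    []      []      (_ , ())
near⇒adjacent (suc _) []      []      (_ , ())
near⇒adjacent (suc c) (a ∷ u) (b ∷ v) (eq , near) with digits-injective a b eq
... | refl , eq′ = adjacent-∷ (near⇒adjacent c u v (eq′ , near))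
near⇒adjacent zero (a ∷ []) (b ∷ []) (_ , near) =
  step⇒adjacent (here (trans (sym (+-identityʳ _)) near))
near⇒adjacent zero (a ∷ a′ ∷ u) (b ∷ b′ ∷ v) (eq , near)
  with code-injective u v eq | ∣ toℕ a - toℕ b ∣ in da | ∣ toℕ a′ - toℕ b′ ∣ in da′
... | refl | 1 | 0 with refl ← Fin.toℕ-injective (∣m-n∣≡0⇒m≡n {toℕ a′} da′) = step⇒adjacent (here da)
... | refl | 0 | 1 with refl ← Fin.toℕ-injective (∣m-n∣≡0⇒m≡n {toℕ a} da)   = step⇒adjacent (there (here da′))

halves : ∀ k → k ≡ 2 * ⌊ k /2⌋ ⊎ k ≡ suc (2 * ⌊ k /2⌋)
halves zero          = inj₁ refl
halves (suc zero)    = inj₂ refl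
halves (suc (suc k)) =
  Sum.map (λ eq → trans (cong (2 +_) eq) (sym (*-suc 2 ⌊ k /2⌋)))
          (λ eq → trans (cong (2 +_) eq) (cong suc (sym (*-suc 2 ⌊ k /2⌋)))) (halves k)

-- Direction `k` is the first or the second of the pair starting at 2⌊k/2⌋, according to its parity.
step⇒near-half : ∀ {d k} {ns : Vec ℕ d} {u v : GridVertex ns} → Step k u v → Near (2 * ⌊ k /2⌋) u v
step⇒near-half {k = k} {u = u} {v} step with halves k
... | inj₁ eq = step⇒near (subst (λ c → Step c u v) eq step)
... | inj₂ eq = next-step⇒near _ (subst (λ c → Step c u v) eq step)

⌊i/2⌋<⌈d/2⌉ : ∀ {i d} → i < d → ⌊ i /2⌋ < ⌈ d /2⌉
-- By computation ⌈d/2⌉ is ⌊(d + 1)/2⌋ and ⌊(i + 2)/2⌋ is 1 + ⌊i/2⌋.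
⌊i/2⌋<⌈d/2⌉ i<d = ⌊n/2⌋-mono (s≤s i<d)

theorem4p1 : ∀ (d : ℕ) → 1 ≤ d → (ns : Vec ℕ d) → (1≤ns : ∀ i → 1 ≤ lookup ns i) →
    IsOrPCG ⌈ d /2⌉ (grid ns 1≤ns)
theorem4p1 d 1≤d ns 1≤ns = record
  { 1≤k    = ⌈n/2⌉-mono 1≤d
  -- Member `i` receives the directions 2i and 2i + 1, counted from 0.
  ; member = λ i → let c = 2 * toℕ i in
      Layers.layers (grid ns 1≤ns) (at c) (at (suc c)) (rest c) (bottom ns 1≤ns) (top ns 1≤ns)
  ; isPCG  = λ i → let c = 2 * toℕ i in
      Layers.layers-isPCG (grid ns 1≤ns) (at c) (at (suc c)) (rest c) (bottom ns 1≤ns) (top ns 1≤ns)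
        (at-bottom c ns 1≤ns) (at-bottom (suc c) ns 1≤ns) (rest-bottom c ns 1≤ns)
        (at≤top c ns 1≤ns) (at≤top (suc c) ns 1≤ns) (rest≤top c ns 1≤ns)
        (coordinates-injective c _ _)
  ; union  = λ u v → mk⇔ (in-some-member u v) λ (i , near) → near⇒adjacent (2 * toℕ i) u v near
  }
  where
  in-some-member : ∀ u v → GridAdjacent u v → ∃ λ (i : Fin ⌈ d /2⌉) → Near (2 * toℕ i) u v
  in-some-member u v u~v =
    let k , step = adjacent⇒step u v u~v
        ⌊k/2⌋<  = ⌊i/2⌋<⌈d/2⌉ (Fin.toℕ<n k)
    in fromℕ< ⌊k/2⌋< ,
       subst (λ h → Near (2 * h) u v) (sym (Fin.toℕ-fromℕ< ⌊k/2⌋<)) (step⇒near-half step)
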